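{- Let $k\geq 2$ be an integer and $R$ a commutative ring. Let $A_1(z),\dots,A_d(z)\in R[[z]]$ be $k$-regular series, let $L_i(x_1,\dots,x_d)=\sum_{j=1}^d c_{ij}(z)x_j$ ($i=1,\dots,d$) be linear forms with coefficients $c_{ij}(z)\in R[z]$, and let $\alpha_1,\dots,\alpha_d\in R$ satisfy $\alpha_i=A_i(0)+\sum_{j=1}^d c_{ij}(0)\alpha_j$ for $i=1,\dots,d$. Then the system $$U_i(z)=A_i(z)+L_i\bigl(U_1(z^k),\dots,U_d(z^k)\bigr),\qquad i=1,\dots,d,$$ has a unique solution $(U_1,\dots,U_d)\in R[[z]]^d$ with $U_i(0)=\alpha_i$ for $i=1,\dots,d$, and $U_1,\dots,U_d$ are all $k$-regular.
   Context: For $0\leq i\leq k-1$, let $\rho(i)$ be the $R$-linear map on $R[[z]]$ given by $\rho(i)\left(\sum_n a(n)z^n\right)=\sum_n a(i+nk)z^n$. The $k$-kernel of $A\in R[[z]]$ is the smallest $R$-submodule of $R[[z]]$ containing $A$ and stable under $\rho(0),\dots,\rho(k-1)$; $A$ is $k$-regular if its $k$-kernel is a finitely generated $R$-module. -}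

module Defs where

open import Level using (_⊔_; suc)
open import Algebra.Bundles using (CommutativeRing)
open import Data.Nat as ℕ using (ℕ; zero; NonZero; _∸_; _%_; _/_)
open import Data.Nat.Properties using (_≟_)
open import Data.Fin using (Fin; toℕ)
import Data.Fin as Fin
open import Data.List using (List; []; _∷_)
open import Data.Product using (Σ; ∃; _×_; _,_)
open import Relation.Nullary using (yes; no)

module PowerSeries {c ℓ} (R : CommutativeRing c ℓ) where
  open CommutativeRing R

  Series : Set c
  Series = ℕ → Carrier

  _≋_ : Series → Series → Set ℓ
  A ≋ B = ∀ n → A n ≈ B n

  sumFin : (n : ℕ) → (Fin n → Carrier) → Carrier
  sumFin zero    f = 0#
  sumFin (ℕ.suc n) f = f Fin.zero + sumFin n (λ i → f (Fin.suc i))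

  Poly : Set c
  Poly = List Carrier

  polyCoeff : Poly → ℕ → Carrier
  polyCoeff []       n         = 0#
  polyCoeff (a ∷ p)  zero      = a
  polyCoeff (a ∷ p)  (ℕ.suc n) = polyCoeff p n

  toSeries : Poly → Series
  toSeries = polyCoeff

  _⊕_ : Series → Series → Series
  (A ⊕ B) n = A n + B n

  zeroS : Series
  zeroS n = 0#

  _·_ : Carrier → Series → Series
  (r · A) n = r * A n

  _⊛_ : Series → Series → Series
  (A ⊛ B) n = sumFin (ℕ.suc n) (λ i → A (toℕ i) * B (n ∸ toℕ i))

  subPow : (k : ℕ) → .{{_ : NonZero k}} → Series → Series
  subPow k U n with n % k ≟ 0
  ... | yes _ = U (n / k)
  ... | no  _ = 0#

  ρ : (k : ℕ) → Fin k → Series → Series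
  ρ k i A n = A (toℕ i ℕ.+ n ℕ.* k)

  data InKernel (k : ℕ) (A : Series) : Series → Set (c ⊔ ℓ) where
    base  : InKernel k A A
    zro   : InKernel k A zeroS
    add   : ∀ {B C} → InKernel k A B → InKernel k A C → InKernel k A (B ⊕ C)
    scal  : ∀ r {B} → InKernel k A B → InKernel k A (r · B)
    rho   : ∀ (i : Fin k) {B} → InKernel k A B → InKernel k A (ρ k i B)
    resp  : ∀ {B C} → B ≋ C → InKernel k A B → InKernel k A C

  IsRegular : ℕ → Series → Set (c ⊔ ℓ)
  IsRegular k A =
    Σ ℕ λ m → Σ (Fin m → Series) λ g →
      (∀ j → InKernel k A (g j)) ×
      (∀ B → InKernel k A B →
        Σ (Fin m → Carrier) λ r → ∀ n → B n ≈ sumFin m (λ j → r j * g j n))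

  at0 : Series → Carrier
  at0 A = A 0

{-# OPTIONS --safe #-}
module Submission where

open import Defs
open import Level using (Level; _⊔_)
open import Algebra.Bundles using (CommutativeMonoid; CommutativeRing)
open import Algebra.Module.Bundles using (LeftModule)
import Algebra.Module.Properties.LeftModule as LeftModuleProperties
import Algebra.Properties.AbelianGroup as AbelianGroupProperties
import Algebra.Properties.CommutativeSemigroup as CommutativeSemigroupProperties
import Algebra.Properties.Monoid.Mult as Mult
import Algebra.Properties.Ring as RingProperties
import Algebra.Properties.Semiring.Exp as Exp
open import Data.Nat using (ℕ; zero; suc; NonZero; _≤_; _<_; _%_; _/_)
import Data.Nat as ℕ
import Data.Nat.Properties as ℕₚ
open import Data.Nat.DivMod using (m≡m%n+[m/n]*n; m%n<n; m/n<m; m*n%n≡0; m*n/n≡m; [m+kn]%n≡m%n;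
         m<n⇒m%n≡m; 0/n≡0)
open import Data.Nat.Induction using (<-rec)
open import Data.Fin using (Fin; toℕ; fromℕ; inject₁)
import Data.Fin as Fin
open import Data.Fin.Properties using (toℕ-fromℕ; toℕ-inject₁; toℕ<n)
open import Data.List using (List; []; _∷_; _++_; concat; length; lookup;
  tabulate; upTo; cartesianProductWith)
open import Data.List.Membership.Propositional using (_∈_)
open import Data.List.Membership.Propositional.Properties
  using (∈-++⁺ˡ; ∈-++⁺ʳ; ∈-++⁻; ∈-concat⁺′; ∈-concat⁻′; ∈-tabulate⁺;
         ∈-tabulate⁻; ∈-lookup; ∈-upTo⁺; ∈-upTo⁻; ∈-cartesianProductWith⁺;
         ∈-cartesianProductWith⁻)
open import Data.List.Properties using (++-identityʳ)
open import Data.List.Relation.Unary.Any using (here; there; index)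
open import Data.List.Relation.Unary.Any.Properties using (lookup-index)
open import Data.Product using (Σ; ∃; ∃₂; _×_; _,_; proj₁; proj₂)
open import Data.Sum using (_⊎_; inj₁; inj₂)
open import Function using (id; _∘_)
open import Relation.Nullary using (yes; no; contradiction)
open import Relation.Binary.PropositionalEquality as ≡ using (_≡_; _≢_)
import Relation.Binary.Reasoning.Setoid as SetoidReasoning
open import Relation.Unary using (Pred; U; _⊆_)

-- Let T bound the degrees of the cᵢⱼ.  Because k ≥ 2, the R-span of all zᵉ Uⱼ and
-- zᵉ g with e ≤ T, for g in generating sets of the k-kernels of the Aᵢ, is stable
-- under every ρ(i).  The k-kernel of Uᵢ is a submodule of this finitely generated
-- module, which for non-Noetherian R does not suffice.  However, the ρ(i) act on
-- the generators through finitely many matrix entries, which generate a Noetherian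
-- subring of R by Hilbert's basis theorem; over that subring the orbit of Uᵢ spans
-- a finitely generated module, and hence it does over R.
--
-- To make this constructive, a module is called Noetherian when the tree of its
-- sequences is barred, inductively, by linear dependence on earlier terms.

-- Finite unions of lists.

module _ {a} {A : Set a} where

  ⋃ : ∀ {n} → (Fin n → List A) → List A
  ⋃ f = concat (tabulate f)

  ∈-⋃⁺ : ∀ {n} (f : Fin n → List A) i {y} → y ∈ f i → y ∈ ⋃ f
  ∈-⋃⁺ f i y∈ = ∈-concat⁺′ y∈ (∈-tabulate⁺ i)

  ∈-⋃⁻ : ∀ {n} (f : Fin n → List A) {y} → y ∈ ⋃ f → ∃ λ i → y ∈ f i
  ∈-⋃⁻ f y∈ with ∈-concat⁻′ (tabulate f) y∈
  ... | ys , y∈ys , ys∈ with ∈-tabulate⁻ ys∈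
  ...   | i , ≡.refl = i , y∈ys

  -- Serves to gather the scalars of all matrix entries into one list; monotonicity lets each `Q i`
  -- survive the enlargement.
  uniform-list : ∀ {n q} {Q : Fin n → Pred (List A) q} →
                 (∀ i {xs ys} → (_∈ xs) ⊆ (_∈ ys) → Q i xs → Q i ys) →
                 (∀ i → ∃ (Q i)) → ∃ λ xs → ∀ i → Q i xs
  uniform-list mono Q =
    ⋃ (proj₁ ∘ Q) , λ i → mono i (∈-⋃⁺ (proj₁ ∘ Q) i) (proj₂ (Q i))

-- Submodules and spans over subrings of R.

module Submodules {c ℓ m ℓm} (R : CommutativeRing c ℓ)
  (M : LeftModule (CommutativeRing.ring R) m ℓm) where

  open CommutativeRing R
    using (Carrier; 1#; _*_; *-comm; semiring)
  open LeftModule M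
  open LeftModuleProperties M
  open Mult +ᴹ-monoid using (×-homo-+; ×-assocˡ) renaming (_×_ to _×ᴹ_)
  open AbelianGroupProperties +ᴹ-abelianGroup
    using (//-rightDividesˡ; //-rightDividesʳ; xyx⁻¹≈y; ⁻¹-∙-comm; ⁻¹-anti-homo‿-)
  open CommutativeSemigroupProperties
    (CommutativeMonoid.commutativeSemigroup +ᴹ-commutativeMonoid)
    using (interchange)
  open Exp semiring using (_^_; ^-homo-*)
  open SetoidReasoning ≈ᴹ-setoid

  private
    κ : Level
    κ = c ⊔ m ⊔ ℓm

  -- `X` is only a set of scalars, so with `X` empty these are subgroups, and
  -- in general submodules over the subring ℤ[X] of R.
  record IsSubmodule {a p} (X : Pred Carrier a) (P : Pred Carrierᴹ p)
         : Set (a ⊔ p ⊔ κ) where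
    field
      resp : ∀ {y z} → y ≈ᴹ z → P y → P z
      zro  : P 0ᴹ
      add  : ∀ {y z} → P y → P z → P (y +ᴹ z)
      neg  : ∀ {y} → P y → P (-ᴹ y)
      act  : ∀ {r y} → X r → P y → P (r *ₗ y)

    sub : ∀ {y z} → P y → P z → P (y +ᴹ -ᴹ z)
    sub py pz = add py (neg pz)

    restrict : ∀ {b} {Y : Pred Carrier b} → Y ⊆ X → IsSubmodule Y P
    restrict Y⊆X = record
      { resp = resp ; zro = zro ; add = add ; neg = neg
      ; act = λ Yr → act (Y⊆X Yr) }

  data Span {a b} (X : Pred Carrier a) (G : Pred Carrierᴹ b)
       : Pred Carrierᴹ (a ⊔ b ⊔ κ) where
    gen  : ∀ {y} → G y → Span X G y
    resp : ∀ {y z} → y ≈ᴹ z → Span X G y → Span X G z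
    zro  : Span X G 0ᴹ
    add  : ∀ {y z} → Span X G y → Span X G z → Span X G (y +ᴹ z)
    neg  : ∀ {y} → Span X G y → Span X G (-ᴹ y)
    act  : ∀ {r y} → X r → Span X G y → Span X G (r *ₗ y)

  module _ {a b} {X : Pred Carrier a} {G : Pred Carrierᴹ b} where

    Span-isSubmodule : IsSubmodule X (Span X G)
    Span-isSubmodule = record
      { resp = resp ; zro = zro ; add = add ; neg = neg ; act = act }

    Span-least : ∀ {p} {P : Pred Carrierᴹ p} →
                 IsSubmodule X P → G ⊆ P → Span X G ⊆ P
    Span-least S G⊆P (gen g)    = G⊆P g
    Span-least S G⊆P (resp e s) = IsSubmodule.resp S e (Span-least S G⊆P s)
    Span-least S G⊆P zro        = IsSubmodule.zro S
    Span-least S G⊆P (add s t)  =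
      IsSubmodule.add S (Span-least S G⊆P s) (Span-least S G⊆P t)
    Span-least S G⊆P (neg s)    = IsSubmodule.neg S (Span-least S G⊆P s)
    Span-least S G⊆P (act r s)  = IsSubmodule.act S r (Span-least S G⊆P s)

  Span-mono : ∀ {a b a′ b′} {X : Pred Carrier a} {G : Pred Carrierᴹ b}
                {X′ : Pred Carrier a′} {G′ : Pred Carrierᴹ b′} →
              X ⊆ X′ → G ⊆ G′ → Span X G ⊆ Span X′ G′
  Span-mono X⊆X′ G⊆G′ =
    Span-least (IsSubmodule.restrict Span-isSubmodule X⊆X′) (gen ∘ G⊆G′)

  Span-∷ : ∀ {a} {X : Pred Carrier a} {y zs} →
           Span X (_∈ zs) ⊆ Span X (_∈ y ∷ zs)
  Span-∷ = Span-mono id there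

  Span-∷-least : ∀ {a p} {X : Pred Carrier a} {P : Pred Carrierᴹ p} {y ys} →
                 IsSubmodule X P → P y → Span X (_∈ ys) ⊆ P →
                 Span X (_∈ y ∷ ys) ⊆ P
  Span-∷-least S Py ⊆P =
    Span-least S (λ { (here ≡.refl) → Py ; (there z∈) → ⊆P (gen z∈) })

  *ₗ-swap : ∀ r s y → r *ₗ (s *ₗ y) ≈ᴹ s *ₗ (r *ₗ y)
  *ₗ-swap r s y = begin
    r *ₗ (s *ₗ y)  ≈⟨ *ₗ-assoc r s y ⟨
    (r * s) *ₗ y   ≈⟨ *ₗ-congʳ (*-comm r s) ⟩
    (s * r) *ₗ y   ≈⟨ *ₗ-assoc s r y ⟩
    s *ₗ (r *ₗ y)  ∎

  -- Linear maps, and submodules of the form sP + Q.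

  record IsLinear (φ : Carrierᴹ → Carrierᴹ) : Set κ where
    field
      cong   : ∀ {y z} → y ≈ᴹ z → φ y ≈ᴹ φ z
      0-homo : φ 0ᴹ ≈ᴹ 0ᴹ
      +-homo : ∀ y z → φ (y +ᴹ z) ≈ᴹ φ y +ᴹ φ z
      *-homo : ∀ r y → φ (r *ₗ y) ≈ᴹ r *ₗ φ y

    -‿homo : ∀ y → φ (-ᴹ y) ≈ᴹ -ᴹ φ y
    -‿homo y = inverseʳ-uniqueᴹ _ _ (begin
      φ y +ᴹ φ (-ᴹ y)  ≈⟨ +-homo y (-ᴹ y) ⟨
      φ (y +ᴹ -ᴹ y)    ≈⟨ cong (-ᴹ‿inverseʳ y) ⟩
      φ 0ᴹ             ≈⟨ 0-homo ⟩
      0ᴹ               ∎)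

    preimage : ∀ {a p} {X : Pred Carrier a} {P : Pred Carrierᴹ p} →
               IsSubmodule X P → IsSubmodule X (P ∘ φ)
    preimage S = record
      { resp = λ e → S.resp (cong e)
      ; zro  = S.resp (≈ᴹ-sym 0-homo) S.zro
      ; add  = λ Py Pz → S.resp (≈ᴹ-sym (+-homo _ _)) (S.add Py Pz)
      ; neg  = λ Py → S.resp (≈ᴹ-sym (-‿homo _)) (S.neg Py)
      ; act  = λ Xr Py → S.resp (≈ᴹ-sym (*-homo _ _)) (S.act Xr Py)
      }
      where module S = IsSubmodule S

  ∘-isLinear : ∀ {φ ψ} → IsLinear φ → IsLinear ψ → IsLinear (φ ∘ ψ)
  ∘-isLinear φ ψ = record
    { cong   = φ.cong ∘ ψ.cong
    ; 0-homo = ≈ᴹ-trans (φ.cong ψ.0-homo) φ.0-homo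
    ; +-homo = λ y z → ≈ᴹ-trans (φ.cong (ψ.+-homo y z)) (φ.+-homo _ _)
    ; *-homo = λ r y → ≈ᴹ-trans (φ.cong (ψ.*-homo r y)) (φ.*-homo r _)
    }
    where
    module φ = IsLinear φ
    module ψ = IsLinear ψ

  *ₗ-isLinear : ∀ s → IsLinear (s *ₗ_)
  *ₗ-isLinear s = record
    { cong   = *ₗ-congˡ
    ; 0-homo = *ₗ-zeroʳ s
    ; +-homo = *ₗ-distribˡ s
    ; *-homo = λ r y → *ₗ-swap s r y
    }

  -- The elimination step of both basis arguments: `u` is a common leading term, and only lower
  -- terms remain.
  sub-cancel : ∀ {y z u q q′} → y ≈ᴹ u +ᴹ q → z ≈ᴹ u +ᴹ q′ →
               y +ᴹ -ᴹ z ≈ᴹ q +ᴹ -ᴹ q′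
  sub-cancel {y} {z} {u} {q} {q′} y≈ z≈ = begin
    y +ᴹ -ᴹ z                      ≈⟨ +ᴹ-cong y≈ (-ᴹ‿cong z≈) ⟩
    (u +ᴹ q) +ᴹ -ᴹ (u +ᴹ q′)       ≈⟨ +ᴹ-congˡ (⁻¹-∙-comm u q′) ⟨
    (u +ᴹ q) +ᴹ (-ᴹ u +ᴹ -ᴹ q′)    ≈⟨ interchange u q (-ᴹ u) (-ᴹ q′) ⟩
    (u +ᴹ -ᴹ u) +ᴹ (q +ᴹ -ᴹ q′)    ≈⟨ +ᴹ-congʳ (-ᴹ‿inverseʳ u) ⟩
    0ᴹ +ᴹ (q +ᴹ -ᴹ q′)             ≈⟨ +ᴹ-identityˡ _ ⟩
    q +ᴹ -ᴹ q′                     ∎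

  module _ (s : Carrier) where

    comb-0 : 0ᴹ ≈ᴹ s *ₗ 0ᴹ +ᴹ 0ᴹ
    comb-0 = ≈ᴹ-sym (≈ᴹ-trans (+ᴹ-identityʳ _) (*ₗ-zeroʳ s))

    comb-+ : ∀ {y z p q p′ q′} → y ≈ᴹ s *ₗ p +ᴹ q → z ≈ᴹ s *ₗ p′ +ᴹ q′ →
             y +ᴹ z ≈ᴹ s *ₗ (p +ᴹ p′) +ᴹ (q +ᴹ q′)
    comb-+ {y} {z} {p} {q} {p′} {q′} y≈ z≈ = begin
      y +ᴹ z                                ≈⟨ +ᴹ-cong y≈ z≈ ⟩
      (s *ₗ p +ᴹ q) +ᴹ (s *ₗ p′ +ᴹ q′)      ≈⟨ interchange _ _ _ _ ⟩
      (s *ₗ p +ᴹ s *ₗ p′) +ᴹ (q +ᴹ q′)      ≈⟨ +ᴹ-congʳ (*ₗ-distribˡ s p p′) ⟨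
      s *ₗ (p +ᴹ p′) +ᴹ (q +ᴹ q′)           ∎

    comb-neg : ∀ {y p q} → y ≈ᴹ s *ₗ p +ᴹ q →
               -ᴹ y ≈ᴹ s *ₗ (-ᴹ p) +ᴹ (-ᴹ q)
    comb-neg {y} {p} {q} y≈ = begin
      -ᴹ y                     ≈⟨ -ᴹ‿cong y≈ ⟩
      -ᴹ (s *ₗ p +ᴹ q)         ≈⟨ ⁻¹-∙-comm _ _ ⟨
      -ᴹ (s *ₗ p) +ᴹ -ᴹ q      ≈⟨ +ᴹ-congʳ (IsLinear.-‿homo (*ₗ-isLinear s) p) ⟨
      s *ₗ (-ᴹ p) +ᴹ (-ᴹ q)    ∎

    comb-act : ∀ r {y p q} → y ≈ᴹ s *ₗ p +ᴹ q →
               r *ₗ y ≈ᴹ s *ₗ (r *ₗ p) +ᴹ r *ₗ q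
    comb-act r {y} {p} {q} y≈ = begin
      r *ₗ y                       ≈⟨ *ₗ-congˡ y≈ ⟩
      r *ₗ (s *ₗ p +ᴹ q)           ≈⟨ *ₗ-distribˡ r _ _ ⟩
      r *ₗ (s *ₗ p) +ᴹ r *ₗ q      ≈⟨ +ᴹ-congʳ (*ₗ-swap r s p) ⟩
      s *ₗ (r *ₗ p) +ᴹ r *ₗ q      ∎

    module _ {p q} (P : Pred Carrierᴹ p) (Q : Pred Carrierᴹ q) where

      Combination : Pred Carrierᴹ (m ⊔ ℓm ⊔ p ⊔ q)
      Combination y = ∃₂ λ u v → P u × Q v × y ≈ᴹ s *ₗ u +ᴹ v

      -- For submodules this is the colon `(P + Q : s)`. With `s = xⁿ` and `Q = Deg< n` its elements
      -- are leading coefficients, as in the classical proof of Hilbert's theorem.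
      Quotient : Pred Carrierᴹ (m ⊔ ℓm ⊔ p ⊔ q)
      Quotient u = ∃₂ λ y v → P y × Q v × y ≈ᴹ s *ₗ u +ᴹ v

    module _ {a p q} {X : Pred Carrier a} {P : Pred Carrierᴹ p}
             {Q : Pred Carrierᴹ q}
             (P-sub : IsSubmodule X P) (Q-sub : IsSubmodule X Q) where
      private
        module P = IsSubmodule P-sub
        module Q = IsSubmodule Q-sub

      Combination-isSubmodule : IsSubmodule X (Combination P Q)
      Combination-isSubmodule = record
        { resp = λ e (u , v , Pu , Qv , y≈) →
            u , v , Pu , Qv , ≈ᴹ-trans (≈ᴹ-sym e) y≈
        ; zro = _ , _ , P.zro , Q.zro , comb-0
        ; add = λ (_ , _ , Pu , Qv , y≈) (_ , _ , Pu′ , Qv′ , z≈) →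
            _ , _ , P.add Pu Pu′ , Q.add Qv Qv′ , comb-+ y≈ z≈
        ; neg = λ (_ , _ , Pu , Qv , y≈) →
            _ , _ , P.neg Pu , Q.neg Qv , comb-neg y≈
        ; act = λ Xr (_ , _ , Pu , Qv , y≈) →
            _ , _ , P.act Xr Pu , Q.act Xr Qv , comb-act _ y≈
        }

      Quotient-isSubmodule : IsSubmodule X (Quotient P Q)
      Quotient-isSubmodule = record
        { resp = λ e (y , v , Py , Qv , y≈) →
            y , v , Py , Qv , ≈ᴹ-trans y≈ (+ᴹ-congʳ (*ₗ-congˡ e))
        ; zro = _ , _ , P.zro , Q.zro , comb-0
        ; add = λ (_ , _ , Py , Qv , y≈) (_ , _ , Pz , Qv′ , z≈) →
            _ , _ , P.add Py Pz , Q.add Qv Qv′ , comb-+ y≈ z≈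
        ; neg = λ (_ , _ , Py , Qv , y≈) →
            _ , _ , P.neg Py , Q.neg Qv , comb-neg y≈
        ; act = λ Xr (_ , _ , Py , Qv , y≈) →
            _ , _ , P.act Xr Py , Q.act Xr Qv , comb-act _ y≈
        }

  -- Noetherian modules and their extensions.

  -- Every sequence in P extending zs reaches a term in the ℤ[X]-span of its
  -- predecessors.
  data Noetherian {a p} (X : Pred Carrier a) (P : Pred Carrierᴹ p)
       (zs : List Carrierᴹ) : Set (a ⊔ p ⊔ κ) where
    next : (∀ y → P y → Span X (_∈ zs) y ⊎ Noetherian X P (y ∷ zs)) →
           Noetherian X P zs

  module _ {a p} {X : Pred Carrier a} {P : Pred Carrierᴹ p} where

    module _ {q} (C : Pred (List Carrierᴹ) q)
             (φ : ∀ zs → (∀ y → P y → Span X (_∈ zs) y ⊎ C (y ∷ zs)) → C zs)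
             where

      -- Bar induction. The recursion under the sum is delegated to `rec-step`, which keeps it
      -- visibly structural.
      Noetherian-rec : Noetherian X P ⊆ C
      rec-step : ∀ {y zs} → Span X (_∈ zs) y ⊎ Noetherian X P (y ∷ zs) →
                 Span X (_∈ zs) y ⊎ C (y ∷ zs)
      Noetherian-rec (next f)   = φ _ (λ y Py → rec-step (f y Py))
      rec-step (inj₁ s) = inj₁ s
      rec-step (inj₂ n) = inj₂ (Noetherian-rec n)

    Noetherian-⊆ : ∀ {q} {Q : Pred Carrierᴹ q} → Q ⊆ P →
                   Noetherian X P ⊆ Noetherian X Q
    Noetherian-⊆ Q⊆P = Noetherian-rec _ (λ zs f → next (λ y Qy → f y (Q⊆P Qy)))

  module _ {a p q} {X : Pred Carrier a} {P : Pred Carrierᴹ p}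
           {Q : Pred Carrierᴹ q} (s : Carrier) (Q-sub : IsSubmodule X Q) where
    private
      module Q = IsSubmodule Q-sub

      -- The invariant of the outer induction: `us` records the first components that were new when
      -- met, and modulo `Q` each of their combinations, multiplied by `s`, is realised in the span
      -- of `zs`.
      Lifts : (us zs : List Carrierᴹ) → Set _
      Lifts us zs = Span X (_∈ us) ⊆ Quotient s (Span X (_∈ zs)) Q

      -- Quantified over all `zs`, because `zs` also grows by elements whose first component adds
      -- nothing to `us`.
      Outer : Pred (List Carrierᴹ) _
      Outer us = ∀ zs → Lifts us zs → Noetherian X (Combination s P Q) zs

      Inner : (us vs : List Carrierᴹ) → Set _
      Inner us vs = ∀ zs → Lifts us zs → Span X (_∈ vs) ⊆ Span X (_∈ zs) →
                    Noetherian X (Combination s P Q) zs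

      Quotient-sub : ∀ {zs} → IsSubmodule X (Quotient s (Span X (_∈ zs)) Q)
      Quotient-sub = Quotient-isSubmodule s Span-isSubmodule Q-sub

      Lifts-∷ : ∀ {us zs y} → Lifts us zs → Lifts us (y ∷ zs)
      Lifts-∷ lift u∈ =
        let w , v , w∈ , Qv , w≈ = lift u∈ in w , v , Span-∷ w∈ , Qv , w≈

    -- For y = s u + v, first run u through the bar of P.  Once u is a
    -- combination of earlier ones, subtracting that combination from y leaves
    -- an element of Q, which is run through the bar of Q.
    Noetherian-extension : Noetherian X P [] → Noetherian X Q [] →
                           Noetherian X (Combination s P Q) []
    Noetherian-extension NP NQ =
      Noetherian-rec Outer outer NP [] (Span-least Quotient-sub (λ ()))
      where
      outer : ∀ us → (∀ u → P u → Span X (_∈ us) u ⊎ Outer (u ∷ us)) → Outer us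
      outer us stepP zs lift =
        Noetherian-rec (Inner us) inner NQ zs lift
          (Span-least Span-isSubmodule (λ ()))
        where
        inner : ∀ vs → (∀ v → Q v → Span X (_∈ vs) v ⊎ Inner us (v ∷ vs)) →
                Inner us vs
        inner vs stepQ zs lift vs⊆zs = next step
          where
          step : ∀ y → Combination s P Q y →
                 Span X (_∈ zs) y ⊎ Noetherian X (Combination s P Q) (y ∷ zs)
          step y (u , v , Pu , Qv , y≈) with stepP u Pu
          ... | inj₂ continue = inj₂ (continue (y ∷ zs)
                  (Span-∷-least Quotient-sub
                    (y , v , gen (here ≡.refl) , Qv , y≈) (Lifts-∷ lift)))
          ... | inj₁ u∈us with lift u∈us
          ...   | w , v′ , w∈zs , Qv′ , w≈
                  with stepQ (v +ᴹ -ᴹ v′) (Q.sub Qv Qv′)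
          ...     | inj₁ d∈vs = inj₁ (resp (//-rightDividesˡ w y)
                      (add (resp (≈ᴹ-sym (sub-cancel y≈ w≈)) (vs⊆zs d∈vs)) w∈zs))
          ...     | inj₂ continue = inj₂ (continue (y ∷ zs) (Lifts-∷ lift)
                      (Span-∷-least Span-isSubmodule
                        (resp (sub-cancel y≈ w≈)
                          (add (gen (here ≡.refl)) (neg (Span-∷ w∈zs))))
                        (Span-∷ ∘ vs⊆zs)))

  -- Hilbert's basis theorem.  P[x] is filtered by Deg< n = P + xP + … + xⁿ⁻¹P.

  module Adjunction (x : Carrier) {xs : List Carrier} {P : Pred Carrierᴹ κ}
                    (P-sub : IsSubmodule (_∈ xs) P) where

    private
      module P = IsSubmodule P-sub

    Deg< : ℕ → Pred Carrierᴹ κ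
    Deg< zero    = Span (_∈ xs) (_∈ [])
    Deg< (suc n) = Combination (x ^ n) P (Deg< n)

    -- These are not formal polynomials: x already acts on M, so an element may have several
    -- expansions and no degree of its own. Hence only an upper bound `n` is recorded.
    P[x] : Pred Carrierᴹ κ
    P[x] y = ∃ λ n → Deg< n y

    Deg<-isSubmodule : ∀ n → IsSubmodule (_∈ xs) (Deg< n)
    Deg<-isSubmodule zero    = Span-isSubmodule
    Deg<-isSubmodule (suc n) =
      Combination-isSubmodule (x ^ n) P-sub (Deg<-isSubmodule n)

    Deg<-suc : ∀ n → Deg< n ⊆ Deg< (suc n)
    Deg<-suc n {y} d = 0ᴹ , y , P.zro , d , (begin
      y                      ≈⟨ +ᴹ-identityˡ y ⟨
      0ᴹ +ᴹ y                ≈⟨ +ᴹ-congʳ (*ₗ-zeroʳ (x ^ n)) ⟨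
      (x ^ n) *ₗ 0ᴹ +ᴹ y     ∎)

    Deg<-+ˡ : ∀ e n → Deg< n ⊆ Deg< (e ℕ.+ n)
    Deg<-+ˡ zero    n d = d
    Deg<-+ˡ (suc e) n d = Deg<-suc (e ℕ.+ n) (Deg<-+ˡ e n d)

    Deg<-+ʳ : ∀ n e → Deg< n ⊆ Deg< (n ℕ.+ e)
    Deg<-+ʳ n e {y} d = ≡.subst (λ k → Deg< k y) (ℕₚ.+-comm e n) (Deg<-+ˡ e n d)

    x-Deg< : ∀ n {y} → Deg< n y → Deg< (suc n) (x *ₗ y)
    x-Deg< zero d =
      Deg<-suc zero (Span-least (IsLinear.preimage (*ₗ-isLinear x) Span-isSubmodule) (λ ()) d)
    x-Deg< (suc n) {y} (u , v , Pu , d , y≈) =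
      u , x *ₗ v , Pu , x-Deg< n d , (begin
        x *ₗ y                            ≈⟨ *ₗ-congˡ y≈ ⟩
        x *ₗ ((x ^ n) *ₗ u +ᴹ v)          ≈⟨ *ₗ-distribˡ x _ _ ⟩
        x *ₗ ((x ^ n) *ₗ u) +ᴹ x *ₗ v     ≈⟨ +ᴹ-congʳ (*ₗ-assoc x (x ^ n) u) ⟨
        (x ^ suc n) *ₗ u +ᴹ x *ₗ v        ∎)

    x^-Deg< : ∀ e n {y} → Deg< n y → Deg< (e ℕ.+ n) ((x ^ e) *ₗ y)
    x^-Deg< zero    n d = IsSubmodule.resp (Deg<-isSubmodule n) (≈ᴹ-sym (*ₗ-identityˡ _)) d
    x^-Deg< (suc e) n d =
      IsSubmodule.resp (Deg<-isSubmodule (suc e ℕ.+ n)) (≈ᴹ-sym (*ₗ-assoc x (x ^ e) _))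
        (x-Deg< (e ℕ.+ n) (x^-Deg< e n d))

    P⊆P[x] : P ⊆ P[x]
    P⊆P[x] {y} Py = 1 , y , 0ᴹ , Py , zro ,
      ≈ᴹ-sym (≈ᴹ-trans (+ᴹ-identityʳ _) (*ₗ-identityˡ y))

    P[x]-isSubmodule : IsSubmodule (_∈ x ∷ xs) P[x]
    P[x]-isSubmodule = record
      { resp = λ e (n , d) → n , IsSubmodule.resp (Deg<-isSubmodule n) e d
      ; zro  = 0 , zro
      ; add  = λ (n , d) (n′ , d′) → n ℕ.+ n′ ,
          IsSubmodule.add (Deg<-isSubmodule (n ℕ.+ n′)) (Deg<-+ʳ n n′ d) (Deg<-+ˡ n n′ d′)
      ; neg  = λ (n , d) → n , IsSubmodule.neg (Deg<-isSubmodule n) d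
      ; act  = λ { (here ≡.refl) (n , d) → suc n , x-Deg< n d
                 ; (there r∈xs)  (n , d) → n , IsSubmodule.act (Deg<-isSubmodule n) r∈xs d }
      }

    module _ (P-noeth : Noetherian (_∈ xs) P []) where

      -- With scalars `xs` alone, each step adjoins one further summand xⁿP, an instance of
      -- `Noetherian-extension`.
      Deg<-Noetherian : ∀ n → Noetherian (_∈ xs) (Deg< n) []
      Deg<-Noetherian zero    = next (λ y d → inj₁ d)
      Deg<-Noetherian (suc n) =
        Noetherian-extension (x ^ n) (Deg<-isSubmodule n) P-noeth (Deg<-Noetherian n)

      private
        ⟨_⟩ ⟨_⟩ₓ : List Carrierᴹ → Pred Carrierᴹ κ
        ⟨ us ⟩  = Span (_∈ xs) (_∈ us)
        ⟨ zs ⟩ₓ = Span (_∈ x ∷ xs) (_∈ zs)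

        ⟨⟩ₓ-isSubmodule : ∀ {zs} → IsSubmodule (_∈ xs) ⟨ zs ⟩ₓ
        ⟨⟩ₓ-isSubmodule = IsSubmodule.restrict Span-isSubmodule there

        -- Every u in ⟨ us ⟩ is the coefficient of xⁿ in some element of
        -- ⟨ zs ⟩ₓ of degree at most n.
        Leads : ℕ → (us zs : List Carrierᴹ) → Set κ
        Leads n us zs = ⟨ us ⟩ ⊆ Quotient (x ^ n) ⟨ zs ⟩ₓ (Deg< n)

        -- Quantified over `n` as well, because a new leading coefficient may appear in a higher
        -- degree, from which the induction then continues.
        Outer : Pred (List Carrierᴹ) κ
        Outer us = ∀ n zs → Leads n us zs → Noetherian (_∈ x ∷ xs) P[x] zs

        Inner : ℕ → (us vs : List Carrierᴹ) → Set κ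
        Inner n us vs = ∀ zs → Leads n us zs → ⟨ vs ⟩ ⊆ ⟨ zs ⟩ₓ →
                        Noetherian (_∈ x ∷ xs) P[x] zs

        Quotient-sub : ∀ n {zs} → IsSubmodule (_∈ xs) (Quotient (x ^ n) ⟨ zs ⟩ₓ (Deg< n))
        Quotient-sub n = Quotient-isSubmodule (x ^ n) ⟨⟩ₓ-isSubmodule (Deg<-isSubmodule n)

        Leads-∷ : ∀ n {us zs y} → Leads n us zs → Leads n us (y ∷ zs)
        Leads-∷ n lead u∈ =
          let w , v , w∈ , d , w≈ = lead u∈ in w , v , Span-∷ w∈ , d , w≈

        x^-⟨⟩ₓ : ∀ e {zs w} → ⟨ zs ⟩ₓ w → ⟨ zs ⟩ₓ ((x ^ e) *ₗ w)
        x^-⟨⟩ₓ zero    w∈ = resp (≈ᴹ-sym (*ₗ-identityˡ _)) w∈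
        x^-⟨⟩ₓ (suc e) w∈ =
          resp (≈ᴹ-sym (*ₗ-assoc x (x ^ e) _)) (act (here ≡.refl) (x^-⟨⟩ₓ e w∈))

        x^-lead : ∀ e {n u v w} → w ≈ᴹ (x ^ n) *ₗ u +ᴹ v →
                  (x ^ e) *ₗ w ≈ᴹ (x ^ (e ℕ.+ n)) *ₗ u +ᴹ (x ^ e) *ₗ v
        x^-lead e {n} {u} {v} {w} w≈ = begin
          (x ^ e) *ₗ w                                  ≈⟨ *ₗ-congˡ w≈ ⟩
          (x ^ e) *ₗ ((x ^ n) *ₗ u +ᴹ v)                ≈⟨ *ₗ-distribˡ _ _ _ ⟩
          (x ^ e) *ₗ ((x ^ n) *ₗ u) +ᴹ (x ^ e) *ₗ v     ≈⟨ +ᴹ-congʳ (*ₗ-assoc _ _ u) ⟨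
          (x ^ e * x ^ n) *ₗ u +ᴹ (x ^ e) *ₗ v          ≈⟨ +ᴹ-congʳ (*ₗ-congʳ (^-homo-* x e n)) ⟨
          (x ^ (e ℕ.+ n)) *ₗ u +ᴹ (x ^ e) *ₗ v          ∎

        -- Multiplying the lifted element by xᵉ raises its degree without changing its leading
        -- coefficient, and x is among the scalars of `⟨ zs ⟩ₓ`.
        Leads-+ : ∀ e n {us zs} → Leads n us zs → Leads (e ℕ.+ n) us zs
        Leads-+ e n lead u∈ =
          let w , v , w∈ , d , w≈ = lead u∈
          in (x ^ e) *ₗ w , (x ^ e) *ₗ v , x^-⟨⟩ₓ e w∈ , x^-Deg< e n d , x^-lead e w≈

      -- Reduce the degree of y modulo zs as long as its leading coefficient is
      -- a combination of earlier ones.  A new leading coefficient descends in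
      -- the bar of P and raises the degree bound n; a remainder of degree < n
      -- descends in the bar of Deg< n.
      P[x]-Noetherian : Noetherian (_∈ x ∷ xs) P[x] []
      P[x]-Noetherian =
        Noetherian-rec Outer outer P-noeth 0 [] (Span-least (Quotient-sub 0) (λ ()))
        where
        outer : ∀ us → (∀ u → P u → ⟨ us ⟩ u ⊎ Outer (u ∷ us)) → Outer us
        outer us stepP n zs lead =
          Noetherian-rec (Inner n us) inner (Deg<-Noetherian n) zs lead
            (Span-least ⟨⟩ₓ-isSubmodule (λ ()))
          where
          inner : ∀ vs → (∀ v → Deg< n v → ⟨ vs ⟩ v ⊎ Inner n us (v ∷ vs)) →
                  Inner n us vs
          inner vs stepQ zs lead vs⊆zs =
            -- The bound e is padded to e + n, so that e eliminations bring `y` below degree n.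
            next (λ y (e , d) → reduce y e y (Deg<-+ʳ e n d) (gen (here ≡.refl)) id)
            where
            -- Here `f` is what remains of `y` after subtracting elements of `⟨ zs ⟩ₓ`, and `back`
            -- undoes these subtractions.
            reduce : ∀ y e f → Deg< (e ℕ.+ n) f → ⟨ y ∷ zs ⟩ₓ f →
                     (⟨ zs ⟩ₓ f → ⟨ zs ⟩ₓ y) →
                     ⟨ zs ⟩ₓ y ⊎ Noetherian (_∈ x ∷ xs) P[x] (y ∷ zs)
            reduce y zero f d f∈ back with stepQ f d
            ... | inj₁ f∈vs     = inj₁ (back (vs⊆zs f∈vs))
            ... | inj₂ continue = inj₂ (continue (y ∷ zs) (Leads-∷ n lead)
                    (Span-∷-least ⟨⟩ₓ-isSubmodule f∈ (Span-∷ ∘ vs⊆zs)))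
            reduce y (suc e) f (u , v , Pu , d , f≈) f∈ back with stepP u Pu
            ... | inj₂ continue = inj₂ (continue (e ℕ.+ n) (y ∷ zs)
                    (Span-∷-least (Quotient-sub (e ℕ.+ n)) (f , v , f∈ , d , f≈)
                      (Leads-∷ (e ℕ.+ n) (Leads-+ e n lead))))
            ... | inj₁ u∈us =
              let w , v′ , w∈zs , d′ , w≈ = Leads-+ e n lead u∈us
                  f-w≈ = sub-cancel f≈ w≈
              in reduce y e (v +ᴹ -ᴹ v′)
                   (IsSubmodule.sub (Deg<-isSubmodule (e ℕ.+ n)) d d′)
                   (resp f-w≈ (add f∈ (neg (Span-∷ w∈zs))))
                   (λ f′∈ → back (resp (//-rightDividesˡ w f)
                     (add (resp (≈ᴹ-sym f-w≈) f′∈) w∈zs)))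

  -- Finitely generated abelian groups are Noetherian.

  ×-closed : ∀ {p} {P : Pred Carrierᴹ p} → IsSubmodule (_∈ []) P →
             ∀ n {y} → P y → P (n ×ᴹ y)
  ×-closed S zero    Py = IsSubmodule.zro S
  ×-closed S (suc n) Py = IsSubmodule.add S Py (×-closed S n Py)

  module _ (h : Carrierᴹ) where

    -- The cyclic group ℤh, each integer being written as a difference of naturals; negation swaps
    -- the two.
    Multiple : Pred Carrierᴹ ℓm
    Multiple y = ∃₂ λ i j → y ≈ᴹ i ×ᴹ h +ᴹ -ᴹ (j ×ᴹ h)

    Multiple-isSubmodule : IsSubmodule (_∈ []) Multiple
    Multiple-isSubmodule = record
      { resp = λ e (i , j , y≈) → i , j , ≈ᴹ-trans (≈ᴹ-sym e) y≈
      ; zro  = 0 , 0 , ≈ᴹ-sym (-ᴹ‿inverseʳ 0ᴹ)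
      ; add  = λ (i , j , y≈) (i′ , j′ , z≈) → i ℕ.+ i′ , j ℕ.+ j′ ,
          (begin
            _ +ᴹ _                                                 ≈⟨ +ᴹ-cong y≈ z≈ ⟩
            (i ×ᴹ h +ᴹ -ᴹ (j ×ᴹ h)) +ᴹ (i′ ×ᴹ h +ᴹ -ᴹ (j′ ×ᴹ h))   ≈⟨ interchange _ _ _ _ ⟩
            (i ×ᴹ h +ᴹ i′ ×ᴹ h) +ᴹ (-ᴹ (j ×ᴹ h) +ᴹ -ᴹ (j′ ×ᴹ h))   ≈⟨ +ᴹ-congˡ (⁻¹-∙-comm _ _) ⟩
            (i ×ᴹ h +ᴹ i′ ×ᴹ h) +ᴹ -ᴹ (j ×ᴹ h +ᴹ j′ ×ᴹ h)
              ≈⟨ +ᴹ-cong (×-homo-+ h i i′) (-ᴹ‿cong (×-homo-+ h j j′)) ⟨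
            (i ℕ.+ i′) ×ᴹ h +ᴹ -ᴹ ((j ℕ.+ j′) ×ᴹ h)                ∎)
      ; neg  = λ (i , j , y≈) → j , i ,
          ≈ᴹ-trans (-ᴹ‿cong y≈) (⁻¹-anti-homo‿- _ _)
      ; act  = λ ()
      }

    -- A subgroup does not distinguish y from its negative, so y may be replaced by |i - j| h and
    -- Euclid's algorithm can run on natural numbers. The same n serves all subgroups.
    ∣Multiple∣ : ∀ {y} → Multiple y →
                 ∃ λ n → ∀ {P : Pred Carrierᴹ κ} → IsSubmodule (_∈ []) P →
                   (P y → P (n ×ᴹ h)) × (P (n ×ᴹ h) → P y)
    ∣Multiple∣ {y} (i , j , y≈) with ℕₚ.≤-total j i
    ... | inj₁ j≤i = i ℕ.∸ j , λ S →
          IsSubmodule.resp S y≈d , IsSubmodule.resp S (≈ᴹ-sym y≈d)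
      where
      y≈d : y ≈ᴹ (i ℕ.∸ j) ×ᴹ h
      y≈d = begin
        y                                           ≈⟨ y≈ ⟩
        i ×ᴹ h +ᴹ -ᴹ (j ×ᴹ h)                       ≡⟨ ≡.cong (λ k → k ×ᴹ h +ᴹ -ᴹ (j ×ᴹ h)) (ℕₚ.m+[n∸m]≡n j≤i) ⟨
        (j ℕ.+ (i ℕ.∸ j)) ×ᴹ h +ᴹ -ᴹ (j ×ᴹ h)       ≈⟨ +ᴹ-congʳ (×-homo-+ h j (i ℕ.∸ j)) ⟩
        (j ×ᴹ h +ᴹ (i ℕ.∸ j) ×ᴹ h) +ᴹ -ᴹ (j ×ᴹ h)   ≈⟨ xyx⁻¹≈y _ _ ⟩
        (i ℕ.∸ j) ×ᴹ h                              ∎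
    ... | inj₂ i≤j = j ℕ.∸ i , λ S →
          (λ Py → IsSubmodule.resp S -y≈d (IsSubmodule.neg S Py)) ,
          (λ Pd → IsSubmodule.resp S (-ᴹ-involutive y)
            (IsSubmodule.neg S (IsSubmodule.resp S (≈ᴹ-sym -y≈d) Pd)))
      where
      -y≈d : -ᴹ y ≈ᴹ (j ℕ.∸ i) ×ᴹ h
      -y≈d = begin
        -ᴹ y                                        ≈⟨ -ᴹ‿cong y≈ ⟩
        -ᴹ (i ×ᴹ h +ᴹ -ᴹ (j ×ᴹ h))                  ≈⟨ ⁻¹-anti-homo‿- _ _ ⟩
        j ×ᴹ h +ᴹ -ᴹ (i ×ᴹ h)                       ≡⟨ ≡.cong (λ k → k ×ᴹ h +ᴹ -ᴹ (i ×ᴹ h)) (ℕₚ.m+[n∸m]≡n i≤j) ⟨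
        (i ℕ.+ (j ℕ.∸ i)) ×ᴹ h +ᴹ -ᴹ (i ×ᴹ h)       ≈⟨ +ᴹ-congʳ (×-homo-+ h i (j ℕ.∸ i)) ⟩
        (i ×ᴹ h +ᴹ (j ℕ.∸ i) ×ᴹ h) +ᴹ -ᴹ (i ×ᴹ h)   ≈⟨ xyx⁻¹≈y _ _ ⟩
        (j ℕ.∸ i) ×ᴹ h                              ∎

    -- Euclid's algorithm: once g h is in the span with g > 0, a further
    -- multiple of h is in the span as well or provides a smaller such g.
    Multiple-Noetherian : Noetherian (_∈ []) Multiple []
    Multiple-Noetherian = next first
      where
      Euclid : Pred ℕ κ
      Euclid g = ∀ zs → .{{NonZero g}} → Span (_∈ []) (_∈ zs) (g ×ᴹ h) →
                 Noetherian (_∈ []) Multiple zs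

      euclid : ∀ g → (∀ {r} → r < g → Euclid r) → Euclid g
      euclid g ih zs gh∈ = next step
        where
        step : ∀ y → Multiple y →
               Span (_∈ []) (_∈ zs) y ⊎ Noetherian (_∈ []) Multiple (y ∷ zs)
        step y My with ∣Multiple∣ My
        ... | n , abs = go (n % g) ≡.refl
          where
          n≈ : n ×ᴹ h ≈ᴹ (n % g) ×ᴹ h +ᴹ (n / g) ×ᴹ (g ×ᴹ h)
          n≈ = begin
            n ×ᴹ h                                      ≡⟨ ≡.cong (_×ᴹ h) (m≡m%n+[m/n]*n n g) ⟩
            (n % g ℕ.+ (n / g) ℕ.* g) ×ᴹ h              ≈⟨ ×-homo-+ h (n % g) _ ⟩
            (n % g) ×ᴹ h +ᴹ ((n / g) ℕ.* g) ×ᴹ h        ≈⟨ +ᴹ-congˡ (×-assocˡ h (n / g) g) ⟨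
            (n % g) ×ᴹ h +ᴹ (n / g) ×ᴹ (g ×ᴹ h)         ∎

          q∈ : Span (_∈ []) (_∈ zs) ((n / g) ×ᴹ (g ×ᴹ h))
          q∈ = ×-closed Span-isSubmodule (n / g) gh∈

          go : ∀ r → n % g ≡ r →
               Span (_∈ []) (_∈ zs) y ⊎ Noetherian (_∈ []) Multiple (y ∷ zs)
          go zero eq =
            let _ , from = abs Span-isSubmodule
            in inj₁ (from (resp (≈ᴹ-sym n≈)
                 (add (≡.subst (λ k → Span (_∈ []) (_∈ zs) (k ×ᴹ h)) (≡.sym eq) zro) q∈)))
          go r@(suc _) eq =
            let to , _ = abs Span-isSubmodule
            in inj₂ (ih (≡.subst (_< g) eq (m%n<n n g)) (y ∷ zs)
                 (≡.subst (λ k → Span (_∈ []) (_∈ y ∷ zs) (k ×ᴹ h)) eq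
                   (resp (≈ᴹ-trans (+ᴹ-congʳ n≈) (//-rightDividesʳ _ _))
                     (add (to (gen (here ≡.refl))) (neg (Span-∷ q∈))))))

      -- The empty list supplies no g > 0 yet: the first term is either zero or starts the descent
      -- with its own n.
      first : ∀ y → Multiple y →
              Span (_∈ []) (_∈ []) y ⊎ Noetherian (_∈ []) Multiple (y ∷ [])
      first y My with ∣Multiple∣ My
      ... | zero      , abs = let _ , from = abs Span-isSubmodule in inj₁ (from zro)
      ... | n@(suc _) , abs =
            let to , _ = abs Span-isSubmodule
            in inj₂ (<-rec Euclid euclid n (y ∷ []) (to (gen (here ≡.refl))))

  -- Induction on the number of generators: the group generated by `h ∷ hs` is 1 · ℤh plus the one
  -- generated by `hs`, an extension with s = 1.
  subgroup-Noetherian : ∀ hs → Noetherian (_∈ []) (Span (_∈ []) (_∈ hs)) []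
  subgroup-Noetherian []       = next (λ y s → inj₁ s)
  subgroup-Noetherian (h ∷ hs) =
    Noetherian-⊆
      (Span-∷-least (Combination-isSubmodule 1# (Multiple-isSubmodule h) Span-isSubmodule)
        (h , 0ᴹ , (1 , 0 , h≈) , zro , ≈ᴹ-sym (≈ᴹ-trans (+ᴹ-identityʳ _) (*ₗ-identityˡ h)))
        (λ {y} y∈ → 0ᴹ , y , IsSubmodule.zro (Multiple-isSubmodule h) , y∈ ,
          ≈ᴹ-sym (≈ᴹ-trans (+ᴹ-congʳ (*ₗ-zeroʳ 1#)) (+ᴹ-identityˡ y))))
      (Noetherian-extension 1# Span-isSubmodule (Multiple-Noetherian h)
        (subgroup-Noetherian hs))
    where
    h≈ : h ≈ᴹ (h +ᴹ 0ᴹ) +ᴹ -ᴹ 0ᴹ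
    h≈ = ≈ᴹ-sym (//-rightDividesʳ 0ᴹ h)

  -- The scalars are adjoined one at a time: with P the span over `xs`, the span over `x ∷ xs` lies
  -- in `P[x]`.
  hilbert : ∀ xs hs → Noetherian (_∈ xs) (Span (_∈ xs) (_∈ hs)) []
  hilbert []       hs = subgroup-Noetherian hs
  hilbert (x ∷ xs) hs =
    Noetherian-⊆ (Span-least P[x]-isSubmodule (P⊆P[x] ∘ gen))
      (P[x]-Noetherian (hilbert xs hs))
    where open Adjunction x {xs} {Span (_∈ xs) (_∈ hs)} Span-isSubmodule

  -- A derivation of membership in a span is a finite tree, so it mentions only finitely many
  -- scalars.
  Span-scalars : ∀ {b} {G : Pred Carrierᴹ b} {y} → Span U G y →
                 ∃ λ xs → Span (_∈ xs) G y
  Span-scalars (gen g)    = [] , gen g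
  Span-scalars (resp e s) = let xs , s′ = Span-scalars s in xs , resp e s′
  Span-scalars zro        = [] , zro
  Span-scalars (add s t)  =
    let xs , s′ = Span-scalars s
        ys , t′ = Span-scalars t
    in xs ++ ys , add (Span-mono ∈-++⁺ˡ id s′) (Span-mono (∈-++⁺ʳ xs) id t′)
  Span-scalars (neg s)    = let xs , s′ = Span-scalars s in xs , neg s′
  Span-scalars (act {r} _ s) =
    let xs , s′ = Span-scalars s
    in r ∷ xs , act (here ≡.refl) (Span-mono there id s′)

  -- Orbits under finitely many linear maps.

  module _ {k} (φ : Fin k → Carrierᴹ → Carrierᴹ) where

    Stable : ∀ {p} → Pred Carrierᴹ p → Set (m ⊔ p)
    Stable P = ∀ i {y} → P y → P (φ i y)

    -- Following the tree u, φ i u, φ j (φ i u), … along every branch until the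
    -- bar is hit leaves finitely many vectors.
    orbit : ∀ {a p q} {X : Pred Carrier a} {P : Pred Carrierᴹ p} {K : Pred Carrierᴹ q} →
            Stable P → Stable K → ∀ {zs} → Noetherian X P zs →
            ∀ u → P u → K u →
            ∃ λ L → (_∈ L) ⊆ K × Span X (_∈ L ++ zs) u ×
                    (∀ i {y} → y ∈ L → Span X (_∈ L ++ zs) (φ i y))
    orbit {X = X} {P} {K} P-stable K-stable = Noetherian-rec Orbit walk
      where
      Orbit : Pred (List Carrierᴹ) _
      Orbit zs = ∀ u → P u → K u →
        ∃ λ L → (_∈ L) ⊆ K × Span X (_∈ L ++ zs) u ×
                (∀ i {y} → y ∈ L → Span X (_∈ L ++ zs) (φ i y))

      walk : ∀ zs → (∀ y → P y → Span X (_∈ zs) y ⊎ Orbit (y ∷ zs)) → Orbit zs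
      walk zs f u Pu Ku with f u Pu
      ... | inj₁ u∈zs     = [] , (λ ()) , u∈zs , λ _ ()
      ... | inj₂ continue =
        u ∷ ⋃ Ls ,
        (λ { (here ≡.refl) → Ku
           ; (there y∈) → let i , y∈Lᵢ = ∈-⋃⁻ Ls y∈ in proj₁ (proj₂ (branch i)) y∈Lᵢ }) ,
        gen (here ≡.refl) ,
        λ { i (here ≡.refl) → ⊆L i (proj₁ (proj₂ (proj₂ (branch i))))
          ; j (there y∈) → let i , y∈Lᵢ = ∈-⋃⁻ Ls y∈
                           in ⊆L i (proj₂ (proj₂ (proj₂ (branch i))) j y∈Lᵢ) }
        where
        branch : ∀ i → _
        branch i = continue (φ i u) (P-stable i Pu) (K-stable i Ku)

        Ls : Fin k → List Carrierᴹ
        Ls i = proj₁ (branch i)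

        ⊆L : ∀ i → Span X (_∈ Ls i ++ u ∷ zs) ⊆ Span X (_∈ u ∷ ⋃ Ls ++ zs)
        ⊆L i = Span-mono id λ y∈ → case-++ (∈-++⁻ (Ls i) y∈)
          where
          case-++ : ∀ {y} → y ∈ Ls i ⊎ y ∈ u ∷ zs → y ∈ u ∷ ⋃ Ls ++ zs
          case-++ (inj₁ y∈)             = there (∈-++⁺ˡ (∈-⋃⁺ Ls i y∈))
          case-++ (inj₂ (here y≡u))     = here y≡u
          case-++ (inj₂ (there y∈zs))   = there (∈-++⁺ʳ (⋃ Ls) y∈zs)

    module _ (φ-linear : ∀ i → IsLinear (φ i)) where

      Span-stable : ∀ {a b} {X : Pred Carrier a} {G : Pred Carrierᴹ b} →
                    (∀ i → G ⊆ Span X G ∘ φ i) → Stable (Span X G)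
      Span-stable G-stable i =
        Span-least (IsLinear.preimage (φ-linear i) Span-isSubmodule) (G-stable i)

      -- R need not be Noetherian: only the subring generated by the finitely
      -- many matrix entries of the φ i with respect to hs matters.
      finite-orbit : ∀ {q} {K : Pred Carrierᴹ q} hs →
                     (∀ i → (_∈ hs) ⊆ Span U (_∈ hs) ∘ φ i) →
                     Stable K → ∀ {u} → u ∈ hs → K u →
                     ∃ λ L → (_∈ L) ⊆ K × Span U (_∈ L) u × Stable (Span U (_∈ L))
      finite-orbit hs hs-stable K-stable {u} u∈hs Ku =
        let xs , entries = scalars
            -- The matrix entries are indexed by positions in `hs`, so membership is first converted
            -- to a position.
            stable = Span-stable λ i {y} y∈ →
              ≡.subst (Span (_∈ xs) (_∈ hs) ∘ φ i) (≡.sym (lookup-index y∈))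
                (entries i (index y∈))
            L , L⊆K , u∈L , L-stable =
              orbit stable K-stable (hilbert xs hs) u (gen u∈hs) Ku
            -- Once `L` is found, the scalars may be enlarged from `xs` to all of R.
            forget : ∀ {y} → Span (_∈ xs) (_∈ L ++ []) y → Span U (_∈ L) y
            forget = Span-mono _ (λ {z} → ≡.subst (z ∈_) (++-identityʳ L))
        in L , L⊆K , forget u∈L , Span-stable (λ i y∈ → forget (L-stable i y∈))
        where
        scalars : ∃ λ xs → ∀ i j → Span (_∈ xs) (_∈ hs) (φ i (lookup hs j))
        scalars =
          uniform-list (λ i xs⊆ys s j → Span-mono xs⊆ys id (s j)) λ i →
          uniform-list (λ j xs⊆ys → Span-mono xs⊆ys id) λ j →
          Span-scalars (hs-stable i (∈-lookup j))

-- Power series as an R-module.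

module SeriesProperties {c ℓ} (R : CommutativeRing c ℓ) where

  open CommutativeRing R
  open PowerSeries R
  open RingProperties ring using (-1*x≈-x)
  open CommutativeSemigroupProperties +-commutativeSemigroup using (interchange)

  seriesModule : LeftModule ring c ℓ
  seriesModule = record
    { Carrierᴹ = Series
    ; _≈ᴹ_ = _≋_
    ; _+ᴹ_ = _⊕_
    ; _*ₗ_ = _·_
    ; 0ᴹ = zeroS
    ; -ᴹ_ = λ A n → - A n
    ; isLeftModule = record
      { isLeftSemimodule = record
        { +ᴹ-isCommutativeMonoid = record
          { isMonoid = record
            { isSemigroup = record
              { isMagma = record
                { isEquivalence = record
                  { refl  = λ n → refl
                  ; sym   = λ e n → sym (e n)
                  ; trans = λ e f n → trans (e n) (f n)
                  }
                ; ∙-cong = λ e f n → +-cong (e n) (f n)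
                }
              ; assoc = λ A B C n → +-assoc (A n) (B n) (C n)
              }
            ; identity = (λ A n → +-identityˡ (A n)) , (λ A n → +-identityʳ (A n))
            }
          ; comm = λ A B n → +-comm (A n) (B n)
          }
        ; isPreleftSemimodule = record
          { *ₗ-cong = λ r≈s e n → *-cong r≈s (e n)
          ; *ₗ-zeroˡ = λ A n → zeroˡ (A n)
          ; *ₗ-distribʳ = λ A r s n → distribʳ (A n) r s
          ; *ₗ-identityˡ = λ A n → *-identityˡ (A n)
          ; *ₗ-assoc = λ r s A n → *-assoc r s (A n)
          ; *ₗ-zeroʳ = λ r n → zeroʳ r
          ; *ₗ-distribˡ = λ r A B n → distribˡ r (A n) (B n)
          }
        }
      ; -ᴹ‿cong = λ e n → -‿cong (e n)
      ; -ᴹ‿inverse = (λ A n → -‿inverseˡ (A n)) , (λ A n → -‿inverseʳ (A n))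
      }
    }

  open Submodules R seriesModule public

  -- Finite sums and linear combinations.

  sumFin-cong : ∀ m {f g : Fin m → Carrier} → (∀ j → f j ≈ g j) → sumFin m f ≈ sumFin m g
  sumFin-cong zero    f≈g = refl
  sumFin-cong (suc m) f≈g = +-cong (f≈g Fin.zero) (sumFin-cong m (f≈g ∘ Fin.suc))

  sumFin-0 : ∀ m {f : Fin m → Carrier} → (∀ j → f j ≈ 0#) → sumFin m f ≈ 0#
  sumFin-0 zero    f≈0 = refl
  sumFin-0 (suc m) f≈0 =
    trans (+-cong (f≈0 Fin.zero) (sumFin-0 m (f≈0 ∘ Fin.suc))) (+-identityˡ 0#)

  sumFin-+ : ∀ m (f g : Fin m → Carrier) →
             sumFin m f + sumFin m g ≈ sumFin m (λ j → f j + g j)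
  sumFin-+ zero    f g = +-identityˡ 0#
  sumFin-+ (suc m) f g =
    trans (interchange _ _ _ _) (+-congˡ (sumFin-+ m (f ∘ Fin.suc) (g ∘ Fin.suc)))

  sumFin-* : ∀ m r (f : Fin m → Carrier) → r * sumFin m f ≈ sumFin m (λ j → r * f j)
  sumFin-* zero    r f = zeroʳ r
  sumFin-* (suc m) r f =
    trans (distribˡ r _ _) (+-congˡ (sumFin-* m r (f ∘ Fin.suc)))

  sumFin-closed : ∀ {p} {P : Pred Series p} → IsSubmodule U P → ∀ m {f : Fin m → Series} →
                  (∀ j → P (f j)) → P (λ n → sumFin m (λ j → f j n))
  sumFin-closed S zero    Pf = IsSubmodule.zro S
  sumFin-closed S (suc m) Pf =
    IsSubmodule.add S (Pf Fin.zero) (sumFin-closed S m (Pf ∘ Fin.suc))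

  -- The span of `L` in the explicit form with coefficients that `IsRegular` asks for.
  LinearCombination : List Series → Pred Series _
  LinearCombination L B = Σ (Fin (length L) → Carrier) λ r →
    ∀ n → B n ≈ sumFin (length L) (λ j → r j * lookup L j n)

  LinearCombination-isSubmodule : ∀ L → IsSubmodule U (LinearCombination L)
  LinearCombination-isSubmodule L = record
    { resp = resp′
    ; zro  = (λ _ → 0#) , λ n → sym (sumFin-0 (length L) (λ j → zeroˡ _))
    ; add  = λ (r , y≈) (s , z≈) → (λ j → r j + s j) , λ n →
        trans (+-cong (y≈ n) (z≈ n)) (trans (sumFin-+ (length L) _ _)
          (sumFin-cong (length L) (λ j → sym (distribʳ _ (r j) (s j)))))
    ; neg  = λ y∈ → resp′ (λ n → -1*x≈-x _) (act′ (- 1#) y∈)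
    ; act  = λ {r} _ → act′ r
    }
    where
    resp′ : ∀ {A B} → A ≋ B → LinearCombination L A → LinearCombination L B
    resp′ e (r , y≈) = r , λ n → trans (sym (e n)) (y≈ n)

    act′ : ∀ s {B} → LinearCombination L B → LinearCombination L (s · B)
    act′ s (r , y≈) = (λ j → s * r j) , λ n →
      trans (*-congˡ (y≈ n)) (trans (sumFin-* (length L) s _)
        (sumFin-cong (length L) (λ j → sym (*-assoc s (r j) _))))

  ∈⇒LinearCombination : ∀ {L} → (_∈ L) ⊆ LinearCombination L
  ∈⇒LinearCombination {B ∷ L} (here ≡.refl) =
    (λ { Fin.zero → 1# ; (Fin.suc _) → 0# }) , λ n → sym
      (trans (+-cong (*-identityˡ (B n)) (sumFin-0 (length L) (λ j → zeroˡ _)))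
        (+-identityʳ (B n)))
  ∈⇒LinearCombination {B ∷ L} (there B′∈) =
    let r , B′≈ = ∈⇒LinearCombination B′∈
    in (λ { Fin.zero → 0# ; (Fin.suc j) → r j }) , λ n →
      trans (B′≈ n) (sym (trans (+-congʳ (zeroˡ (B n))) (+-identityˡ _)))

  -- The k-kernel.

  InKernel-least : ∀ {k A p} {P : Pred Series p} →
                   IsSubmodule U P → Stable (ρ k) P → P A → InKernel k A ⊆ P
  InKernel-least S stable PA base         = PA
  InKernel-least S stable PA zro          = IsSubmodule.zro S
  InKernel-least S stable PA (add s t)    =
    IsSubmodule.add S (InKernel-least S stable PA s) (InKernel-least S stable PA t)
  InKernel-least S stable PA (scal r s)   =
    IsSubmodule.act S {r} _ (InKernel-least S stable PA s)
  InKernel-least S stable PA (rho i s)    = stable i (InKernel-least S stable PA s)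
  InKernel-least S stable PA (resp e s)   = IsSubmodule.resp S e (InKernel-least S stable PA s)

  -- The span contains `A` and is stable, hence contains the whole k-kernel by minimality.
  generators⇒regular : ∀ {k A} L → (_∈ L) ⊆ InKernel k A →
                       Span U (_∈ L) A → Stable (ρ k) (Span U (_∈ L)) → IsRegular k A
  generators⇒regular L L⊆ A∈ stable =
    length L , lookup L , (λ j → L⊆ (∈-lookup j)) , λ B B∈ →
      Span-least (LinearCombination-isSubmodule L) ∈⇒LinearCombination
        (InKernel-least Span-isSubmodule stable A∈ B∈)

  ρ-isLinear : ∀ k i → IsLinear (ρ k i)
  ρ-isLinear k i = record
    { cong   = λ e n → e _
    ; 0-homo = λ n → refl
    ; +-homo = λ A B n → refl
    ; *-homo = λ r A n → refl
    }

  -- Multiplication by powers of z, and its interaction with ρ.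

  shift : Series → Series
  shift A zero    = 0#
  shift A (suc n) = A n

  shift-isLinear : IsLinear shift
  shift-isLinear = record
    { cong   = λ { e zero → refl ; e (suc n) → e n }
    ; 0-homo = λ { zero → refl ; (suc n) → refl }
    ; +-homo = λ { A B zero → sym (+-identityˡ 0#) ; A B (suc n) → refl }
    ; *-homo = λ { r A zero → sym (zeroʳ r) ; r A (suc n) → refl }
    }

  shift^ : ℕ → Series → Series
  shift^ zero    A = A
  shift^ (suc e) A = shift (shift^ e A)

  shift^-isLinear : ∀ e → IsLinear (shift^ e)
  shift^-isLinear zero    = record
    { cong = id ; 0-homo = λ n → refl ; +-homo = λ A B n → refl ; *-homo = λ r A n → refl }
  shift^-isLinear (suc e) = ∘-isLinear shift-isLinear (shift^-isLinear e)

  shift^-shift : ∀ e A → shift^ e (shift A) ≡ shift^ (suc e) A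
  shift^-shift zero    A = ≡.refl
  shift^-shift (suc e) A = ≡.cong shift (shift^-shift e A)

  -- ρᵢ(zᵉ A) = zᵗ ρⱼ(A), where i − e = j − t k.
  ρ-shift^ : ∀ k e i A → ∃₂ λ t j → toℕ i ℕ.+ t ℕ.* k ≡ e ℕ.+ toℕ j ×
             ρ k i (shift^ e A) ≋ shift^ t (ρ k j A)
  ρ-shift^ k       zero    i A = 0 , i , ℕₚ.+-identityʳ _ , λ n → refl
  -- The modulus is `suc k` here, and index 0 wraps around to the largest index: ρ₀(zB) = z ρₖ(B).
  ρ-shift^ (suc k) (suc e) Fin.zero A =
    let t , j , eq , A≋ = ρ-shift^ (suc k) e (fromℕ k) A
    in suc t , j ,
       ≡.cong suc (≡.trans (≡.cong (ℕ._+ t ℕ.* suc k) (≡.sym (toℕ-fromℕ k))) eq) ,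
       λ { zero    → refl
         ; (suc n) → trans
             (reflexive (≡.cong (λ i → shift^ e A (i ℕ.+ n ℕ.* suc k)) (≡.sym (toℕ-fromℕ k))))
             (A≋ n) }
  -- No wrap-around: ρᵢ₊₁(zB) = ρᵢ(B).
  ρ-shift^ (suc k) (suc e) (Fin.suc i) A =
    let t , j , eq , A≋ = ρ-shift^ (suc k) e (inject₁ i) A
    in t , j ,
       ≡.cong suc (≡.trans (≡.cong (ℕ._+ t ℕ.* suc k) (≡.sym (toℕ-inject₁ i))) eq) ,
       λ n → trans
         (reflexive (≡.cong (λ i → shift^ e A (i ℕ.+ n ℕ.* suc k)) (≡.sym (toℕ-inject₁ i))))
         (A≋ n)

  -- Products with polynomials, and the substitution of zᵏ for z.

  ⊛-[] : ∀ B → (toSeries [] ⊛ B) ≋ zeroS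
  ⊛-[] B n = sumFin-0 (suc n) (λ i → zeroˡ (B (n ℕ.∸ toℕ i)))

  -- Horner's rule (a + zp)B = aB + z(pB), which permits recursion on the coefficient list.
  ⊛-∷ : ∀ a p B → (toSeries (a ∷ p) ⊛ B) ≋ ((a · B) ⊕ shift (toSeries p ⊛ B))
  ⊛-∷ a p B zero    = refl
  ⊛-∷ a p B (suc n) = refl

  ⊛-cong : ∀ A {B C n} → (∀ m → m ≤ n → B m ≈ C m) → (A ⊛ B) n ≈ (A ⊛ C) n
  ⊛-cong A {n = n} B≈C =
    sumFin-cong (suc n) (λ i → *-congˡ {A (toℕ i)} (B≈C _ (ℕₚ.m∸n≤m n (toℕ i))))

  module _ (k : ℕ) .{{_ : NonZero k}} where

    subPow-cong : ∀ {F G} n → F (n / k) ≈ G (n / k) → subPow k F n ≈ subPow k G n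
    subPow-cong n F≈G with n % k ℕₚ.≟ 0
    ... | yes _ = F≈G
    ... | no  _ = refl

    subPow-multiple : ∀ F n → subPow k F (n ℕ.* k) ≡ F n
    subPow-multiple F n with (n ℕ.* k) % k ℕₚ.≟ 0
    ... | yes _   = ≡.cong F (m*n/n≡m n k)
    ... | no  ≢0  = contradiction (m*n%n≡0 n k) ≢0

    subPow-nonmultiple : ∀ F n → n % k ≢ 0 → subPow k F n ≡ 0#
    subPow-nonmultiple F n ≢0 with n % k ℕₚ.≟ 0
    ... | yes ≡0 = contradiction ≡0 ≢0
    ... | no  _  = ≡.refl

    ρ-subPow-0 : ∀ F i → toℕ i ≡ 0 → ρ k i (subPow k F) ≋ F
    ρ-subPow-0 F i i≡0 n = reflexive
      (≡.trans (≡.cong (λ i → subPow k F (i ℕ.+ n ℕ.* k)) i≡0) (subPow-multiple F n))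

    ρ-subPow-≢0 : ∀ F i → toℕ i ≢ 0 → ρ k i (subPow k F) ≋ zeroS
    ρ-subPow-≢0 F i i≢0 n = reflexive (subPow-nonmultiple F _ λ ≡0 →
      i≢0 (≡.trans (≡.sym (m<n⇒m%n≡m (toℕ<n i)))
        (≡.trans (≡.sym ([m+kn]%n≡m%n (toℕ i) n k)) ≡0)))

upper-bound : ∀ {n} (f : Fin n → ℕ) → ∃ λ b → ∀ i → f i ≤ b
upper-bound {zero}  f = 0 , λ ()
upper-bound {suc n} f =
  let b , f≤b = upper-bound (f ∘ Fin.suc)
  in f Fin.zero ℕ.⊔ b ,
     λ { Fin.zero → ℕₚ.m≤m⊔n _ b ; (Fin.suc i) → ℕₚ.≤-trans (f≤b i) (ℕₚ.m≤n⊔m _ b) }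

-- The functional system.

module MahlerSystem {c ℓ} (R : CommutativeRing c ℓ) (k : ℕ) .{{_ : NonZero k}} (2≤k : 2 ≤ k)
  (d : ℕ)
  (A : Fin d → PowerSeries.Series R) (C : Fin d → Fin d → PowerSeries.Poly R) where

  open CommutativeRing R
  open PowerSeries R
  open SeriesProperties R

  rhs : (Fin d → Series) → Fin d → Series
  rhs F i = A i ⊕ λ n → sumFin d (λ j → (toSeries (C i j) ⊛ subPow k (F j)) n)

  -- Regularity of every solution.

  module _ (A-regular : ∀ i → IsRegular k (A i))
           (F : Fin d → Series) (F-solution : ∀ i → F i ≋ rhs F i) where

    private
      degree-bound : ∃ λ T → ∀ i j → length (C i j) ≤ T
      degree-bound =
        let b , ≤b = upper-bound (λ i → proj₁ (upper-bound (λ j → length (C i j))))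
        in b , λ i j → ℕₚ.≤-trans (proj₂ (upper-bound (λ j → length (C i j))) j) (≤b i)

      T : ℕ
      T = proj₁ degree-bound

      generators : ∀ i → List Series
      generators i = tabulate (proj₁ (proj₂ (A-regular i)))

      Bs hs : List Series
      Bs = tabulate F ++ ⋃ generators
      hs = cartesianProductWith shift^ (upTo (suc T)) Bs

      V : Pred Series _
      V = Span U (_∈ hs)

      shift^∈hs : ∀ {t B} → t ≤ T → B ∈ Bs → shift^ t B ∈ hs
      shift^∈hs t≤T B∈ = ∈-cartesianProductWith⁺ shift^ (∈-upTo⁺ (ℕ.s≤s t≤T)) B∈

      kernel-shift^ : ∀ {i B} → InKernel k (A i) B → ∀ {t} → t ≤ T → V (shift^ t B)
      -- The equation is kept in order to identify `g` with the series listed in `generators i`.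
      kernel-shift^ {i} {B} B∈ {t} t≤T with A-regular i in eq
      ... | m , g , g∈ , span =
        let r , B≈ = span B B∈
            S = IsLinear.preimage (shift^-isLinear t) Span-isSubmodule
        in IsSubmodule.resp S (λ n → sym (B≈ n)) (sumFin-closed S m (λ j →
             IsSubmodule.act S {r j} _ (gen (shift^∈hs t≤T
               (∈-++⁺ʳ (tabulate F) (∈-⋃⁺ generators i
                 (≡.subst (λ reg → g j ∈ tabulate (proj₁ (proj₂ reg))) (≡.sym eq)
                   (∈-tabulate⁺ j))))))))

      ρ-shift^-preimage : ∀ i e → IsSubmodule U (λ B → V (ρ k i (shift^ e B)))
      ρ-shift^-preimage i e =
        IsLinear.preimage (∘-isLinear (ρ-isLinear k i) (shift^-isLinear e)) Span-isSubmodule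

      -- From t k ≤ e + j < e + k ≤ (e + 1) k: applying ρ never raises the exponent of z.
      t≤e : ∀ {i t e j} → i ℕ.+ t ℕ.* k ≡ e ℕ.+ j → j < k → t ≤ e
      t≤e {i} {t} {e} {j} eq j<k = ℕₚ.≮⇒≥ λ e<t → ℕₚ.<-irrefl ≡.refl (begin-strict
        e ℕ.+ j          <⟨ ℕₚ.+-monoʳ-< e j<k ⟩
        e ℕ.+ k          ≡⟨ ℕₚ.+-comm e k ⟩
        k ℕ.+ e          ≤⟨ ℕₚ.+-monoʳ-≤ k (ℕₚ.m≤m*n e k) ⟩
        suc e ℕ.* k      ≤⟨ ℕₚ.*-monoˡ-≤ k e<t ⟩
        t ℕ.* k          ≤⟨ ℕₚ.m≤n+m (t ℕ.* k) i ⟩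
        i ℕ.+ t ℕ.* k    ≡⟨ eq ⟩
        e ℕ.+ j          ∎)
        where open ℕₚ.≤-Reasoning

      -- Here k ≥ 2 enters: 2t ≤ t k ≤ e ≤ 2T, so exponents up to 2T return to the range covered by
      -- `hs`.
      t≤T : ∀ {i t e} → i ℕ.+ t ℕ.* k ≡ e → e ≤ T ℕ.+ T → t ≤ T
      t≤T {i} {t} {e} eq e≤2T = ℕₚ.*-cancelʳ-≤ t T 2 (begin
        t ℕ.* 2          ≤⟨ ℕₚ.*-monoʳ-≤ t 2≤k ⟩
        t ℕ.* k          ≤⟨ ℕₚ.m≤n+m (t ℕ.* k) i ⟩
        i ℕ.+ t ℕ.* k    ≡⟨ eq ⟩
        e                ≤⟨ e≤2T ⟩
        T ℕ.+ T          ≡⟨ ≡.cong (T ℕ.+_) (ℕₚ.+-identityʳ T) ⟨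
        2 ℕ.* T          ≡⟨ ℕₚ.*-comm 2 T ⟩
        T ℕ.* 2          ∎)
        where open ℕₚ.≤-Reasoning

      -- By `ρ-shift^` the series is zᵗ ρⱼ(B) with t ≤ e, and ρⱼ(B) is again in the k-kernel.
      kernel-ρ : ∀ i e → e ≤ T → ∀ {l B} → InKernel k (A l) B → V (ρ k i (shift^ e B))
      kernel-ρ i e e≤T {B = B} B∈ =
        let t , j , eq , B≋ = ρ-shift^ k e i B
        in resp (λ n → sym (B≋ n))
             (kernel-shift^ (rho j B∈) {t} (ℕₚ.≤-trans (t≤e {toℕ i} eq (toℕ<n j)) e≤T))

      -- By `ρ-shift^` the series is zᵗ ρⱼ(F(zᵏ)), which is zᵗF for j = 0 and zero for all other j.
      subPow-ρ : ∀ i e → e ≤ T ℕ.+ T → ∀ l → V (ρ k i (shift^ e (subPow k (F l))))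
      subPow-ρ i e e≤2T l with ρ-shift^ k e i (subPow k (F l))
      ... | t , j , eq , ≋ with toℕ j ℕₚ.≟ 0
      ...   | yes j≡0 =
        resp (λ n → sym (trans (≋ n) (IsLinear.cong (shift^-isLinear t) (ρ-subPow-0 k (F l) j j≡0) n)))
          (gen (shift^∈hs {t}
            (t≤T {toℕ i} (≡.trans eq (≡.trans (≡.cong (e ℕ.+_) j≡0) (ℕₚ.+-identityʳ e))) e≤2T)
            (∈-++⁺ˡ (∈-tabulate⁺ l))))
      ...   | no  j≢0 =
        resp (λ n → sym (trans (≋ n) (trans
          (IsLinear.cong (shift^-isLinear t) (ρ-subPow-≢0 k (F l) j j≢0) n)
          (IsLinear.0-homo (shift^-isLinear t) n)))) zro

      -- Horner's rule moves one factor z at a time from the polynomial into the exponent e, so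
      -- `e + length p` stays constant in the recursion.
      ⊛-ρ : ∀ i l p e → e ℕ.+ length p ≤ T ℕ.+ T →
            V (ρ k i (shift^ e (toSeries p ⊛ subPow k (F l))))
      ⊛-ρ i l []      e e≤ =
        let module S = IsSubmodule (ρ-shift^-preimage i e)
        in S.resp (λ n → sym (⊛-[] (subPow k (F l)) n)) S.zro
      ⊛-ρ i l (a ∷ p) e e≤ =
        let module S = IsSubmodule (ρ-shift^-preimage i e)
            X = subPow k (F l)
        in S.resp (λ n → sym (⊛-∷ a p X n))
             (S.add (S.act {a} _ (subPow-ρ i e (ℕₚ.m+n≤o⇒m≤o e e≤) l))
               (≡.subst (V ∘ ρ k i) (≡.sym (shift^-shift e (toSeries p ⊛ X)))
                 (⊛-ρ i l p (suc e) (≡.subst (_≤ T ℕ.+ T) (ℕₚ.+-suc e (length p)) e≤))))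

      -- Both e and deg cᵢⱼ are at most T, so zᵉ cᵢⱼ(z) has degree at most 2T,
      -- and applying ρ to zᵉ cᵢⱼ(z) Uⱼ(zᵏ) divides exponents by k ≥ 2.
      Bs-ρ : ∀ i e → e ≤ T → ∀ {B} → B ∈ Bs → V (ρ k i (shift^ e B))
      Bs-ρ i e e≤T {B} B∈ with ∈-++⁻ (tabulate F) B∈
      ... | inj₁ B∈F with ∈-tabulate⁻ B∈F
      ...   | l , ≡.refl =
        let module S = IsSubmodule (ρ-shift^-preimage i e)
        in S.resp (λ n → sym (F-solution l n))
             (S.add (kernel-ρ i e e≤T base)
               (sumFin-closed (ρ-shift^-preimage i e) d (λ j →
                 ⊛-ρ i j (C l j) e (ℕₚ.+-mono-≤ e≤T (proj₂ degree-bound l j)))))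
      Bs-ρ i e e≤T {B} B∈ | inj₂ B∈g with ∈-⋃⁻ generators B∈g
      ... | l , B∈gₗ with ∈-tabulate⁻ B∈gₗ
      ...   | j , ≡.refl = kernel-ρ i e e≤T (proj₁ (proj₂ (proj₂ (A-regular l))) j)

      hs-ρ : ∀ i → (_∈ hs) ⊆ V ∘ ρ k i
      hs-ρ i h∈ with ∈-cartesianProductWith⁻ shift^ (upTo (suc T)) Bs h∈
      ... | e , B , e∈ , B∈ , ≡.refl = Bs-ρ i e (ℕ.s≤s⁻¹ (∈-upTo⁻ e∈)) B∈

    solution-regular : ∀ i → IsRegular k (F i)
    solution-regular i =
      let L , L⊆ , F∈ , stable =
            -- The orbit is followed inside the k-kernel of `F i`, so the generators found belong to
            -- it; `F i` itself is listed in `hs` with exponent 0.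
            finite-orbit (ρ k) (ρ-isLinear k) hs hs-ρ rho
              (shift^∈hs ℕ.z≤n (∈-++⁺ˡ (∈-tabulate⁺ i))) base
      in generators⇒regular L L⊆ F∈ stable

  -- Uniqueness and existence of the solution.

  rhs-cong : ∀ {F G} n → (∀ j m → m < suc n → F j m ≈ G j m) →
             ∀ i → rhs F i (suc n) ≈ rhs G i (suc n)
  rhs-cong n F≈G i = +-congˡ (sumFin-cong d λ j → ⊛-cong (toSeries (C i j)) λ m m≤ →
    subPow-cong k m (F≈G j (m / k) (quotient< m m≤)))
    where
    -- Since k ≥ 2, a positive coefficient of the right-hand side uses only strictly earlier
    -- coefficients. At index 0 the quotient is again 0, which is why constant terms are prescribed.
    quotient< : ∀ m → m ≤ suc n → m / k < suc n
    quotient< zero    _  = ≡.subst (_< suc n) (≡.sym (0/n≡0 k)) (ℕ.s≤s ℕ.z≤n)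
    quotient< m@(suc _) m≤ = ℕₚ.<-≤-trans (m/n<m m k 2≤k) m≤

  solution-unique : ∀ {F G} → (∀ i → F i ≋ rhs F i) → (∀ i → G i ≋ rhs G i) →
                    (∀ i → at0 (F i) ≈ at0 (G i)) → ∀ i → F i ≋ G i
  solution-unique {F} {G} F≈ G≈ F0≈G0 i n =
    <-rec (λ n → ∀ i → F i n ≈ G i n) step n i
    where
    step : ∀ n → (∀ {m} → m < n → ∀ i → F i m ≈ G i m) → ∀ i → F i n ≈ G i n
    step zero    ih i = F0≈G0 i
    step (suc n) ih i =
      trans (F≈ i (suc n)) (trans (rhs-cong n (λ j m m< → ih m< j) i) (sym (G≈ i (suc n))))

  module _ (α : Fin d → Carrier)
           (α≈ : ∀ i → α i ≈ at0 (A i) + sumFin d (λ j → at0 (toSeries (C i j)) * α j)) where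

    -- Iteration of the system with `f` as fuel, as the indices m / k are not structurally smaller.
    -- The starting value `α i` is meant only for index 0; each round settles at least one more
    -- coefficient.
    approximant : ℕ → Fin d → Series
    approximant zero    i n       = α i
    approximant (suc f) i zero    = α i
    approximant (suc f) i (suc n) = rhs (approximant f) i (suc n)

    approximant-0 : ∀ f i → approximant f i 0 ≡ α i
    approximant-0 zero    i = ≡.refl
    approximant-0 (suc f) i = ≡.refl

    approximant-stable : ∀ f g n → n ≤ f → n ≤ g → ∀ i → approximant f i n ≈ approximant g i n
    approximant-stable f g zero _ _ i =
      reflexive (≡.trans (approximant-0 f i) (≡.sym (approximant-0 g i)))
    approximant-stable (suc f) (suc g) (suc n) (ℕ.s≤s n≤f) (ℕ.s≤s n≤g) i =
      rhs-cong n (λ j m m≤n → approximant-stable f g m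
        (ℕₚ.≤-trans (ℕ.s≤s⁻¹ m≤n) n≤f) (ℕₚ.≤-trans (ℕ.s≤s⁻¹ m≤n) n≤g) j) i

    -- The diagonal: by `approximant-stable`, n rounds settle coefficient n.
    solution : Fin d → Series
    solution i n = approximant n i n

    solution-solves : ∀ i → solution i ≋ rhs solution i
    -- At index 0 each convolution has the single term cᵢⱼ(0)αⱼ, so the equation is the hypothesis
    -- on α.
    solution-solves i zero = trans (α≈ i) (+-congˡ (sumFin-cong d λ j → sym
      (trans (+-identityʳ _)
        (*-congˡ (reflexive (subPow-multiple k (solution j) 0))))))
    solution-solves i (suc n) =
      rhs-cong n (λ j m m≤n → approximant-stable n m m (ℕ.s≤s⁻¹ m≤n) ℕₚ.≤-refl j) i

mainTheorem5 : ∀ {c ℓ : Level} (R : CommutativeRing c ℓ) →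
  let open CommutativeRing R in
  let open PowerSeries R in
  (k : ℕ) → .{{_ : NonZero k}} → 2 ≤ k →
  (d : ℕ) →
  (A : Fin d → Series) → (∀ i → IsRegular k (A i)) →
  (C : Fin d → Fin d → Poly) →
  (α : Fin d → Carrier) →
  (∀ i → α i ≈ at0 (A i) + sumFin d (λ j → at0 (toSeries (C i j)) * α j)) →
  Σ (Fin d → Series) λ U →
    ((∀ i → U i ≋ (A i ⊕ λ n → sumFin d (λ j → (toSeries (C i j) ⊛ subPow k (U j)) n)))
     × (∀ i → at0 (U i) ≈ α i)
     × (∀ i → IsRegular k (U i)))
    × (∀ (V : Fin d → Series) →
         (∀ i → V i ≋ (A i ⊕ λ n → sumFin d (λ j → (toSeries (C i j) ⊛ subPow k (V j)) n))) →
         (∀ i → at0 (V i) ≈ α i) →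
         ∀ i → V i ≋ U i)
mainTheorem5 R k 2≤k d A A-regular C α α≈ =
  solution α α≈ ,
  (solution-solves α α≈ ,
   (λ i → refl) ,
   solution-regular A-regular (solution α α≈) (solution-solves α α≈)) ,
  λ V V≈ V0≈α → solution-unique V≈ (solution-solves α α≈) V0≈α
  where
  open CommutativeRing R using (refl)
  open MahlerSystem R k 2≤k d A C
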